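{- Let $\phi:\mathbb{N}_0\to\mathbb{N}_0$ satisfy $\phi(0)=0$ and $\phi(x)\neq x$ for all $x\in\mathbb{N}$, and let $n\ge2$. Assume the local function $\phi_n$ has no cycle. Let $p_\nu=|\{x\in D_n: h(x)=\nu\}|$ for $1\le\nu\le n$, let $m=\max\{\nu\in\{1,\dots,n\}: p_\nu\ge1\}$, and $\pi=(p_1,\dots,p_m)$. Then $\pi$ is an ordered partition (composition) of $n$ of length $m$, $1\le m\le n$, with $p_1,\dots,p_m\ge1$. Moreover: (1) $M_n(\phi)$ is nilpotent of degree $m$. (2) For $1\le k\le m$, \[ M_n(\phi)^k=\sum_{x\in D_n:\ \phi_n^k(x)\in D_n} E_n(\phi_n^k(x),x),\qquad \#M_n(\phi)^k=n-\sum_{\nu=1}^k p_\nu. \] (3) Writing $\widehat{M}_n(\phi)^{ -1}=(\mathbf{v}_1,\dots,\mathbf{v}_n)$ by columns, we have $\mathbf{v}_j=\mathbf{e}_j+\sum_{\nu=1}^{h(j)-1}\mathbf{e}_{\phi_n^\nu(j)}$ for $1\le j\le n$, and \[ \#\widehat{M}_n(\phi)^{ -1}=\sum_{x\in D_n}h(x)=\sum_{\nu=1}^m\nu p_\nu\le nm-\binom{m}{2}. \]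
   Context: $\mathbb{N}=\{1,2,\dots\}$, $\mathbb{N}_0=\mathbb{N}\cup\{0\}$, $D_n=\{1,\dots,n\}$, $D_{n,0}=D_n\cup\{0\}$. The local function $\phi_n:D_{n,0}\to D_{n,0}$ is $\phi_n(x)=\phi(x)$ if $x\in D_n$ and $\phi(x)\in D_n$, and $\phi_n(x)=0$ otherwise. "$\phi_n$ has no cycle" means there are no $m\ge2$ and $x\in D_n$ with $\phi_n^m(x)=x$. The height of $x\in D_n$ is $h(x)=\min\{k\in\mathbb{N}:\phi_n^k(x)=0\}$. For $1\le i\le n$, $\mathbf{e}_i$ is the $i$-th unit vector in $\mathbb{Z}^n$ and $\mathbf{e}_0$ the zero vector; $E_n(i,j)=\mathbf{e}_i\mathbf{e}_j^t$. $M_n(\phi)$ is the $n\times n$ matrix whose $j$-th column is $\mathbf{e}_{\phi_n(j)}$, and $\widehat{M}_n(\phi)=I-M_n(\phi)$. $\#A$ denotes the number of nonzero entries of a matrix $A$. A matrix $A$ is nilpotent of degree $k$ if $A^k=0$ and $A^{k-1}\ne0$. -}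

module Defs where

open import Algebra.Bundles using (CommutativeRing)
open import Data.Bool.Base using (if_then_else_)
open import Data.Fin.Base using (Fin; zero; suc; toℕ; fromℕ<)
import Data.Fin.Properties as Fin
open import Data.Integer.Base as ℤ using (ℤ; 0ℤ; 1ℤ)
import Data.Integer.Properties as ℤ
open import Data.Nat.Base using (ℕ; zero; suc; _≤_; s≤s; _∸_)
import Data.Nat.Properties as ℕ
open import Data.Product.Base using (_×_; ∃₂)
open import Data.Vec.Base using (count; allFin)
open import Data.Vec.Functional using (Vector; transpose)
import Function.Endo.Propositional as Endo
open import Relation.Binary.PropositionalEquality.Core using (_≡_; _≢_)
open import Relation.Nullary using (¬_; Dec; yes; no; does; ¬?)
open import Relation.Unary using (Pred; Decidable)

open import Algebra.Properties.Semiring.Sum ℕ.+-*-semiring public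
  using () renaming (sum to sumℕ)
open import Algebra.Properties.Semiring.Sum (CommutativeRing.semiring ℤ.+-*-commutativeRing) public
  using () renaming (sum to sumℤ)

-- D_{n,0} = {0,…,n} is Fin (suc n), and D_n = {1,…,n} is Fin n, where
-- i : Fin n stands for the number suc (toℕ i).  The inclusion of D_n in
-- D_{n,0} is therefore the constructor suc, and its image consists of the
-- elements different from zero.

∈D : ∀ {n} → Fin (suc n) → Set
∈D y = y ≢ zero

∈D? : ∀ {n} (y : Fin (suc n)) → Dec (∈D y)
∈D? y = ¬? (y Fin.≟ zero)

-- If φ x = 0 then the first alternative below also gives zero.
local : (ℕ → ℕ) → (n : ℕ) → Fin (suc n) → Fin (suc n)
local φ n zero = zero
local φ n (suc i) with φ (suc (toℕ i)) ℕ.≤? n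
... | yes φx≤n = fromℕ< (s≤s φx≤n)
... | no  _    = zero

iterate : (ℕ → ℕ) → (n : ℕ) → ℕ → Fin (suc n) → Fin (suc n)
iterate φ n k = local φ n ^ k
  where open Endo (Fin (suc n)) using (_^_)

HasCycle : (ℕ → ℕ) → ℕ → Set
HasCycle φ n = ∃₂ λ (m : ℕ) (x : Fin n) → 2 ≤ m × iterate φ n m (suc x) ≡ suc x

IsMin IsMax : (ℕ → Set) → ℕ → Set
IsMin P k = P k × (∀ j → P j → k ≤ j)
IsMax P k = P k × (∀ j → P j → j ≤ k)

-- As a relation, because the minimum exists only if the orbit of x
-- reaches 0.
IsHeight : (φ : ℕ → ℕ) (n : ℕ) → Fin n → ℕ → Set
IsHeight φ n x = IsMin λ k → 1 ≤ k × iterate φ n k (suc x) ≡ zero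

levelSize : ∀ {n} → (Fin n → ℕ) → ℕ → ℕ
levelSize {n} h ν = count (λ x → h x ℕ.≟ ν) (allFin n)

-- ∑₁ k f = f 1 + … + f k
∑₁ : ℕ → (ℕ → ℕ) → ℕ
∑₁ k f = sumℕ {k} λ i → f (suc (toℕ i))

IsComposition : ℕ → ∀ {m} → Vector ℕ m → Set
IsComposition n π = (∀ i → 1 ≤ π i) × sumℕ π ≡ n

Vecℤ : ℕ → Set
Vecℤ n = Vector ℤ n

infixl 6 _+ᵥ_
_+ᵥ_ : ∀ {n} → Vecℤ n → Vecℤ n → Vecℤ n
(u +ᵥ v) i = u i ℤ.+ v i

-- ∑ᵥ k f = f 1 + … + f k
∑ᵥ : ∀ {n} → ℕ → (ℕ → Vecℤ n) → Vecℤ n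
∑ᵥ k f i = sumℤ {k} λ ν → f (suc (toℕ ν)) i

-- A i j is the entry in row i and column j.
Mat : ℕ → Set
Mat n = Vector (Vecℤ n) n

infix 4 _≈_
_≈_ : ∀ {n} → Mat n → Mat n → Set
A ≈ B = ∀ i j → A i j ≡ B i j

column : ∀ {n} → Mat n → Fin n → Vecℤ n
column = transpose

-- Indexed by D_{n,0}: the zero vector at 0.
e : ∀ {n} → Fin (suc n) → Vecℤ n
e zero    i = 0ℤ
e (suc j) i = if does (i Fin.≟ j) then 1ℤ else 0ℤ

E : ∀ {n} → Fin (suc n) → Fin (suc n) → Mat n
E a b i j = e a i ℤ.* e b j

0M I : ∀ {n} → Mat n
0M i j = 0ℤ
I  i j = e (suc j) i

infixl 6 _-M_
_-M_ : ∀ {n} → Mat n → Mat n → Mat n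
(A -M B) i j = A i j ℤ.- B i j

infixl 7 _*M_
_*M_ : ∀ {n} → Mat n → Mat n → Mat n
(A *M B) i j = sumℤ λ k → A i k ℤ.* B k j

infixr 8 _^M_
_^M_ : ∀ {n} → Mat n → ℕ → Mat n
A ^M zero  = I
A ^M suc k = A *M A ^M k

∑M-where : ∀ {n p} {P : Pred (Fin n) p} → Decidable P → (Fin n → Mat n) → Mat n
∑M-where P? F i j = sumℤ λ x → if does (P? x) then F x i j else 0ℤ

nonzeros : ∀ {n} → Mat n → ℕ
nonzeros {n} A = sumℕ λ j → count (λ i → ¬? (A i j ℤ.≟ 0ℤ)) (allFin n)

-- For k = 0 the two conditions contradict each other, so the truncated
-- subtraction does no harm.
IsNilpotentOfDegree : ∀ {n} → Mat n → ℕ → Set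
IsNilpotentOfDegree A k = A ^M k ≈ 0M × ¬ (A ^M (k ∸ 1) ≈ 0M)

IsInverse : ∀ {n} → Mat n → Mat n → Set
IsInverse A B = A *M B ≈ I × B *M A ≈ I

M : (φ : ℕ → ℕ) (n : ℕ) → Mat n
M φ n i j = e (local φ n (suc j)) i

M̂ : (φ : ℕ → ℕ) (n : ℕ) → Mat n
M̂ φ n = I -M M φ n

{-# OPTIONS --safe #-}
-- Column j of M^k is e at f^k(j), with f the local function and e at 0 zero.
-- Without cycles every orbit reaches 0 within n steps (pigeonhole), so the
-- orbit sums e(j) + e(f j) + … + e(f^(n-1) j) are the columns of the inverse of
-- I - M: both products telescope to e(j) - e(f^n j) = e(j).  An orbit visits no
-- point twice, so column j has exactly h(j) nonzero entries.  The formulas with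
-- the level sizes p_ν are double counts of the pairs (x , h x), every level up to
-- the maximal height m is inhabited by a point of one orbit of length m, and the
-- final inequality is ∑ (m - ν) p_ν ≥ ∑ (m - ν).

module Submission where

open import Defs
open import Algebra.Bundles using (CommutativeRing; Monoid)
import Algebra.Properties.Monoid.Sum as MonoidSum
import Algebra.Properties.Semiring.Sum as SemiringSum
open import Data.Bool.Base using (Bool; true; false; if_then_else_)
open import Data.Fin.Base using (Fin; zero; suc; toℕ; fromℕ<; punchOut)
import Data.Fin.Properties as Fin
open import Data.Integer.Base as ℤ using (ℤ; 0ℤ; 1ℤ; +_)
import Data.Integer.Properties as ℤ
import Data.Integer.Tactic.RingSolver as ℤSolver
open import Data.List.Base using (allFin)
open import Data.List.Membership.Propositional.Properties using (∈-allFin)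
import Data.List.Relation.Unary.All as All
open import Data.Nat.Base using (ℕ; >-nonZero; zero; suc; _+_; _≤_; _<_; z≤n; s≤s; _*_; _∸_)
open import Data.Nat.Combinatorics using (_C_; nC1≡n; nCk+nC[k+1]≡[n+1]C[k+1])
import Data.Nat.Properties as ℕ
import Data.Nat.Tactic.RingSolver as ℕSolver
open import Data.Product.Base using (_×_; Σ-syntax; ∃; _,_; proj₁; proj₂)
import Data.Vec.Base as Vec
open import Function.Base using (_∘_)
import Function.Endo.Propositional as Endo
open import Relation.Binary.PropositionalEquality
  using (_≡_; _≢_; _≗_; refl; sym; trans; cong; cong₂; subst; cong-app; module ≡-Reasoning)
open import Relation.Nullary using (¬_; Dec; yes; no; does; ¬?; _×-dec_; contradiction)
open import Relation.Nullary.Decidable using (dec-true; dec-false; decidable-stable)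
open import Relation.Unary using (Decidable)
open import Data.List.Extrema ℕ.≤-totalOrder using (argmax; f[xs]≤f[argmax])

private
  module Σℕ = SemiringSum ℕ.+-*-semiring
  module Σℤ = SemiringSum (CommutativeRing.semiring ℤ.+-*-commutativeRing)

-- Finite sums, minima and integer subtraction.

⟦_⟧ : Bool → ℕ
⟦ b ⟧ = if b then 1 else 0

module _ {c ℓ} (R : Monoid c ℓ) where
  open Monoid R using (Carrier; ε; ∙-congˡ; identityˡ; identityʳ)
    renaming (_≈_ to _≈ᴿ_; trans to transᴿ)
  open MonoidSum R

  -- For an arbitrary monoid, since it serves both counts in `ℕ` and matrix products over `ℤ`.
  sum-select : ∀ {n} (g : Fin n → Carrier) j →
    sum (λ i → if does (i Fin.≟ j) then g i else ε) ≈ᴿ g j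
  sum-select {suc n} g zero    = transᴿ (∙-congˡ (sum-replicate-zero n)) (identityʳ _)
  sum-select {suc n} g (suc j) = transᴿ (identityˡ _) (sum-select (g ∘ suc) j)

count-tabulate : ∀ {A : Set} {P : A → Set} (P? : Decidable P) {n} (g : Fin n → A) →
  Vec.count P? (Vec.tabulate g) ≡ sumℕ (λ i → ⟦ does (P? (g i)) ⟧)
count-tabulate P? {zero}  g = refl
count-tabulate P? {suc n} g with does (P? (g zero))
... | true  = cong suc (count-tabulate P? (g ∘ suc))
... | false = count-tabulate P? (g ∘ suc)

term≤sum : ∀ {n} (g : Fin n → ℕ) i → g i ≤ sumℕ g
term≤sum g zero    = ℕ.m≤m+n _ _
term≤sum g (suc i) = ℕ.≤-trans (term≤sum (g ∘ suc) i) (ℕ.m≤n+m _ _)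

-- Linear search upwards from `zero`; the known witness `k` bounds it.
least : ∀ {P : ℕ → Set} → Decidable P → ∀ k → P k → ∃ (IsMin P)
least P? zero    pk = zero , pk , λ _ _ → z≤n
least P? (suc k) pk with P? zero
... | yes p₀ = zero , p₀ , λ _ _ → z≤n
... | no ¬p₀ with least (P? ∘ suc) k pk
...   | l , pl , l≤ = suc l , pl , λ where
          zero    p₀ → contradiction p₀ ¬p₀
          (suc j) pj → s≤s (l≤ j pj)

-- Counts are proved as additions in `ℕ`; this carries them over to `ℤ`, where subtraction does not
-- truncate.
a+c≡b⇒a≡b-c : ∀ {a b c} → a + c ≡ b → + a ≡ + b ℤ.- + c
a+c≡b⇒a≡b-c {a} {b} {c} refl = sym (begin
  + (a + c) ℤ.- + c  ≡⟨ ℤ.m-n≡m⊖n (a + c) c ⟩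
  (a + c) ℤ.⊖ c      ≡⟨ ℤ.⊖-≥ (ℕ.m≤n+m c a) ⟩
  + (a + c ∸ c)      ≡⟨ cong +_ (ℕ.m+n∸n≡m a c) ⟩
  + a                ∎)
  where open ≡-Reasoning

a+c≤b⇒a≤b-c : ∀ {a b c} → a + c ≤ b → + a ℤ.≤ + b ℤ.- + c
a+c≤b⇒a≤b-c {a} {b} {c} a+c≤b = subst (+ a ℤ.≤_)
  (a+c≡b⇒a≡b-c (ℕ.m∸n+n≡m (ℕ.m+n≤o⇒n≤o a a+c≤b)))
  (ℤ.+≤+ (ℕ.m+n≤o⇒m≤o∸n a a+c≤b))

[a-b]+[b-c]≡a-c : ∀ a b c → (a ℤ.- b) ℤ.+ (b ℤ.- c) ≡ a ℤ.- c
[a-b]+[b-c]≡a-c = ℤSolver.solve-∀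

-- Levels of a function

levelSize-sum : ∀ {n} (h : Fin n → ℕ) ν → levelSize h ν ≡ sumℕ (λ x → ⟦ does (h x ℕ.≟ ν) ⟧)
levelSize-sum h ν = count-tabulate (λ x → h x ℕ.≟ ν) (λ x → x)

levelSize≥1 : ∀ {n} (h : Fin n → ℕ) {ν} x → h x ≡ ν → 1 ≤ levelSize h ν
levelSize≥1 h {ν} x hx≡ν = begin
  1                                    ≡⟨ cong ⟦_⟧ (dec-true (h x ℕ.≟ ν) hx≡ν) ⟨
  ⟦ does (h x ℕ.≟ ν) ⟧                  ≤⟨ term≤sum (λ x → ⟦ does (h x ℕ.≟ ν) ⟧) x ⟩
  sumℕ (λ x → ⟦ does (h x ℕ.≟ ν) ⟧)     ≡⟨ levelSize-sum h ν ⟨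
  levelSize h ν                        ∎
  where open ℕ.≤-Reasoning

levelSize≡0 : ∀ {n} (h : Fin n → ℕ) {ν} → (∀ x → h x ≢ ν) → levelSize h ν ≡ 0
levelSize≡0 {n} h {ν} h≢ν = begin
  levelSize h ν                      ≡⟨ levelSize-sum h ν ⟩
  sumℕ (λ x → ⟦ does (h x ℕ.≟ ν) ⟧)   ≡⟨ Σℕ.sum-cong-≗ (λ x → cong ⟦_⟧ (dec-false (h x ℕ.≟ ν) (h≢ν x))) ⟩
  sumℕ {n} (λ _ → 0)                 ≡⟨ Σℕ.sum-replicate-zero n ⟩
  0                                  ∎
  where open ≡-Reasoning

-- Only the index `ν = a` contributes, and by `1 ≤ a` it is in range exactly when `a ≤ k`. The
-- induction shifts `g` and `a` together.
∑₁-select : ∀ (g : ℕ → ℕ) k {a} → 1 ≤ a →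
  ∑₁ k (λ ν → g ν * ⟦ does (a ℕ.≟ ν) ⟧) ≡ (if does (a ℕ.≤? k) then g a else 0)
∑₁-select g zero    {suc a}       _ = refl
∑₁-select g (suc k) {suc zero}    _ = begin
  g 1 * 1 + sumℕ {k} (λ i → g (suc (suc (toℕ i))) * 0)
    ≡⟨ cong₂ _+_ (ℕ.*-identityʳ (g 1)) (Σℕ.sum-cong-≗ {k} (λ i → ℕ.*-zeroʳ (g (suc (suc (toℕ i)))))) ⟩
  g 1 + sumℕ {k} (λ _ → 0)
    ≡⟨ cong (λ z → g 1 + z) (Σℕ.sum-replicate-zero k) ⟩
  g 1 + 0
    ≡⟨ ℕ.+-identityʳ (g 1) ⟩
  g 1  ∎
  where open ≡-Reasoning
∑₁-select g (suc k) {suc (suc a)} _ =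
  cong₂ _+_ (ℕ.*-zeroʳ (g 1)) (∑₁-select (g ∘ suc) k {suc a} (s≤s z≤n))

-- Double counting: after interchanging the sums, each `x` contributes only at `ν = h x`. Weight 1
-- gives cumulative level sizes, weight `ν` the sum of the heights.
∑₁-levels : ∀ {n} (h : Fin n → ℕ) → (∀ x → 1 ≤ h x) → ∀ (g : ℕ → ℕ) k →
  ∑₁ k (λ ν → g ν * levelSize h ν) ≡ sumℕ (λ x → if does (h x ℕ.≤? k) then g (h x) else 0)
∑₁-levels {n} h h≥1 g k = begin
  ∑₁ k (λ ν → g ν * levelSize h ν)
    ≡⟨ Σℕ.sum-cong-≗ {k} (λ i → let ν = suc (toℕ i) in
         trans (cong (g ν *_) (levelSize-sum h ν)) (Σℕ.*-distribˡ-sum (g ν) (λ x → ⟦ does (h x ℕ.≟ ν) ⟧))) ⟩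
  ∑₁ k (λ ν → sumℕ λ x → g ν * ⟦ does (h x ℕ.≟ ν) ⟧)
    ≡⟨ Σℕ.∑-comm {k} {n} (λ i x → g (suc (toℕ i)) * ⟦ does (h x ℕ.≟ suc (toℕ i)) ⟧) ⟩
  sumℕ (λ x → ∑₁ k λ ν → g ν * ⟦ does (h x ℕ.≟ ν) ⟧)
    ≡⟨ Σℕ.sum-cong-≗ (λ x → ∑₁-select g k (h≥1 x)) ⟩
  sumℕ (λ x → if does (h x ℕ.≤? k) then g (h x) else 0)  ∎
  where open ≡-Reasoning

∑₁-levelSize : ∀ {n} (h : Fin n → ℕ) → (∀ x → 1 ≤ h x) → ∀ k →
  ∑₁ k (levelSize h) ≡ sumℕ (λ x → ⟦ does (h x ℕ.≤? k) ⟧)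
∑₁-levelSize h h≥1 k = trans
  (Σℕ.sum-cong-≗ {k} (λ i → sym (ℕ.*-identityˡ (levelSize h (suc (toℕ i))))))
  (∑₁-levels h h≥1 (λ _ → 1) k)

sum-ones : ∀ n → sumℕ {n} (λ _ → 1) ≡ n
sum-ones zero    = refl
sum-ones (suc n) = cong suc (sum-ones n)

∑₁-levelSize-all : ∀ {n} (h : Fin n → ℕ) → (∀ x → 1 ≤ h x) → ∀ {m} → (∀ x → h x ≤ m) →
  ∑₁ m (levelSize h) ≡ n
∑₁-levelSize-all {n} h h≥1 {m} h≤m = begin
  ∑₁ m (levelSize h)                   ≡⟨ ∑₁-levelSize h h≥1 m ⟩
  sumℕ (λ x → ⟦ does (h x ℕ.≤? m) ⟧)   ≡⟨ Σℕ.sum-cong-≗ (λ x → cong ⟦_⟧ (dec-true (h x ℕ.≤? m) (h≤m x))) ⟩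
  sumℕ {n} (λ _ → 1)                   ≡⟨ sum-ones n ⟩
  n                                    ∎
  where open ≡-Reasoning

sum≡∑₁-levels : ∀ {n} (h : Fin n → ℕ) → (∀ x → 1 ≤ h x) → ∀ {m} → (∀ x → h x ≤ m) →
  sumℕ h ≡ ∑₁ m (λ ν → ν * levelSize h ν)
sum≡∑₁-levels h h≥1 {m} h≤m = sym (trans (∑₁-levels h h≥1 (λ ν → ν) m)
  (Σℕ.sum-cong-≗ (λ x → cong (if_then h x else 0) (dec-true (h x ℕ.≤? m) (h≤m x)))))

-- With the subtraction cleared, this is ∑ (m - ν) p_ν ≥ ∑ (m - ν) = `m C 2`. The induction removes
-- level 1 and lowers every other weight by one, which splits off `Q`.
∑₁-weighted-bound : ∀ m (p : ℕ → ℕ) → (∀ (i : Fin m) → 1 ≤ p (suc (toℕ i))) →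
  ∑₁ m (λ ν → ν * p ν) + m C 2 ≤ ∑₁ m p * m
∑₁-weighted-bound zero    p p≥1 = z≤n
∑₁-weighted-bound (suc m) p p≥1 = begin
  (1 * p 1 + sumℕ {m} (λ i → q i + suc (toℕ i) * q i)) + suc m C 2
    ≡⟨ cong₂ (λ s c → 1 * p 1 + s + c) (Σℕ.∑-distrib-+ q (λ i → suc (toℕ i) * q i))
         (trans (sym (nCk+nC[k+1]≡[n+1]C[k+1] m 1)) (cong (_+ m C 2) (nC1≡n m))) ⟩
  (1 * p 1 + (Q + T)) + (m + m C 2)
    ≡⟨ regroup (p 1) Q T m (m C 2) ⟩
  p 1 + Q + (T + m C 2) + m
    -- The `m` left over from Pascal's rule is absorbed by `p 1 * m`, because `p 1 ≥ 1`.
    ≤⟨ ℕ.+-mono-≤ (ℕ.+-monoʳ-≤ (p 1 + Q) (∑₁-weighted-bound m (p ∘ suc) (p≥1 ∘ suc)))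
         (ℕ.m≤n*m m (p 1) {{>-nonZero (p≥1 zero)}}) ⟩
  p 1 + Q + Q * m + p 1 * m
    ≡⟨ expand (p 1) Q m ⟩
  (p 1 + Q) * suc m  ∎
  where
  open ℕ.≤-Reasoning
  q : Fin m → ℕ
  q i = p (suc (suc (toℕ i)))
  Q = sumℕ q
  T = sumℕ (λ i → suc (toℕ i) * q i)
  regroup : ∀ a b c d e → (1 * a + (b + c)) + (d + e) ≡ a + b + (c + e) + d
  regroup = ℕSolver.solve-∀
  expand : ∀ a b d → a + b + b * d + a * d ≡ (a + b) * suc d
  expand = ℕSolver.solve-∀

-- Matrix entries

nz : ℤ → ℕ
nz z = ⟦ does (¬? (z ℤ.≟ 0ℤ)) ⟧

nonzeros-sum : ∀ {n} (A : Mat n) → nonzeros A ≡ sumℕ (λ j → sumℕ (λ i → nz (A i j)))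
nonzeros-sum A = Σℕ.sum-cong-≗ λ j → count-tabulate (λ i → ¬? (A i j ℤ.≟ 0ℤ)) (λ i → i)

nz-indicator : ∀ b → nz (if b then 1ℤ else 0ℤ) ≡ ⟦ b ⟧
nz-indicator true  = refl
nz-indicator false = refl

nz-e : ∀ {n} (y : Fin (suc n)) → sumℕ (λ i → nz (e y i)) ≡ ⟦ does (∈D? y) ⟧
nz-e {n} zero    = Σℕ.sum-replicate-zero n
nz-e     (suc j) = trans (Σℕ.sum-cong-≗ (λ i → nz-indicator (does (i Fin.≟ j))))
                         (sum-select ℕ.+-0-monoid (λ _ → 1) j)

e-diag : ∀ {n} (j : Fin n) → e (suc j) j ≡ 1ℤ
e-diag j = cong (if_then 1ℤ else 0ℤ) (dec-true (j Fin.≟ j) refl)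

e-off : ∀ {n} (y : Fin (suc n)) i → y ≢ suc i → e y i ≡ 0ℤ
e-off zero    i _    = refl
e-off (suc j) i j≢i  = cong (if_then 1ℤ else 0ℤ) (dec-false (i Fin.≟ j) (j≢i ∘ cong suc ∘ sym))

-- A function on D_{n,0} vanishing at 0 is compatible with reading 0 as the zero vector, so pairing
-- with `e y` evaluates it even at `y = zero`. The matrix products below reduce to this.
sum-*-e : ∀ {n} (G : Fin (suc n) → ℤ) → G zero ≡ 0ℤ → ∀ y →
  sumℤ (λ l → G (suc l) ℤ.* e y l) ≡ G y
sum-*-e {n} G G0 zero = trans (Σℤ.sum-cong-≗ (λ l → ℤ.*-zeroʳ (G (suc l))))
                              (trans (Σℤ.sum-replicate-zero n) (sym G0))
sum-*-e G G0 (suc j) = trans (Σℤ.sum-cong-≗ (λ l → pull (does (l Fin.≟ j)) (G (suc l))))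
                             (sum-select ℤ.+-0-monoid (G ∘ suc) j)
  where
  pull : ∀ b z → z ℤ.* (if b then 1ℤ else 0ℤ) ≡ (if b then z else 0ℤ)
  pull true  z = ℤ.*-identityʳ z
  pull false z = ℤ.*-zeroʳ z

e-sym : ∀ {n} (i j : Fin n) → e (suc i) j ≡ e (suc j) i
e-sym i j = by-cases (i Fin.≟ j)
  where
  by-cases : Dec (i ≡ j) → e (suc i) j ≡ e (suc j) i
  by-cases (yes refl) = refl
  by-cases (no i≢j)   = trans (e-off (suc i) j (i≢j ∘ Fin.suc-injective))
                              (sym (e-off (suc j) i (i≢j ∘ sym ∘ Fin.suc-injective)))

-- Iterates of a self-map of D_{n,0}

module Iteration {n : ℕ} (f : Fin (suc n) → Fin (suc n)) (f0≡0 : f zero ≡ zero) where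

  open Endo (Fin (suc n)) using (_^_; ^-homo)

  ^-suc : ∀ k y → (f ^ suc k) y ≡ (f ^ k) (f y)
  ^-suc zero    y = refl
  ^-suc (suc k) y = cong f (^-suc k y)

  ^-+ : ∀ j k y → (f ^ (j + k)) y ≡ (f ^ j) ((f ^ k) y)
  ^-+ j k y = cong-app (^-homo f j k) y

  ^-zero : ∀ k → (f ^ k) zero ≡ zero
  ^-zero zero    = refl
  ^-zero (suc k) = trans (cong f (^-zero k)) f0≡0

  ^≡0-mono : ∀ {j k} y → j ≤ k → (f ^ j) y ≡ zero → (f ^ k) y ≡ zero
  ^≡0-mono {j} {k} y j≤k fʲ≡0 = begin
    (f ^ k) y                  ≡⟨ cong (λ l → (f ^ l) y) (ℕ.m∸n+n≡m j≤k) ⟨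
    (f ^ (k ∸ j + j)) y        ≡⟨ ^-+ (k ∸ j) j y ⟩
    (f ^ (k ∸ j)) ((f ^ j) y)  ≡⟨ cong (f ^ (k ∸ j)) fʲ≡0 ⟩
    (f ^ (k ∸ j)) zero         ≡⟨ ^-zero (k ∸ j) ⟩
    zero                       ∎
    where open ≡-Reasoning

  A : Mat n
  A i j = e (f (suc j)) i

  -- Multiplying by `A` applies `f` to the index of a unit vector; `f0≡0` makes this hold for the
  -- zero vector as well.
  A^-entry : ∀ k i j → (A ^M k) i j ≡ e ((f ^ k) (suc j)) i
  A^-entry zero    i j = refl
  A^-entry (suc k) i j = trans
    (Σℤ.sum-cong-≗ (λ l → cong (A i l ℤ.*_) (A^-entry k l j)))
    (sum-*-e (λ y → e (f y) i) (cong (λ y → e y i) f0≡0) ((f ^ k) (suc j)))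

  A^-sum : ∀ k → A ^M k ≈
    ∑M-where (λ x → ∈D? ((f ^ k) (suc x))) (λ x → E ((f ^ k) (suc x)) (suc x))
  A^-sum k i j = begin
    (A ^M k) i j
      ≡⟨ A^-entry k i j ⟩
    e ((f ^ k) (suc j)) i
      ≡⟨ sum-*-e (λ y → e ((f ^ k) y) i) (cong (λ y → e y i) (^-zero k)) (suc j) ⟨
    sumℤ (λ x → e ((f ^ k) (suc x)) i ℤ.* e (suc j) x)
      -- `E` carries the factor `e (suc x) j`, hence the symmetry; terms with image 0 vanish, so
      -- restricting to D_n changes nothing.
      ≡⟨ Σℤ.sum-cong-≗ (λ x → trans (cong (e ((f ^ k) (suc x)) i ℤ.*_) (e-sym j x))
           (restrict ((f ^ k) (suc x)) (e (suc x) j))) ⟩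
    ∑M-where (λ x → ∈D? ((f ^ k) (suc x))) (λ x → E ((f ^ k) (suc x)) (suc x)) i j  ∎
    where
    open ≡-Reasoning
    restrict : ∀ y z → e y i ℤ.* z ≡ (if does (∈D? y) then e y i ℤ.* z else 0ℤ)
    restrict zero    z = refl
    restrict (suc _) z = refl

  nonzeros-A^ : ∀ k → nonzeros (A ^M k) ≡ sumℕ (λ j → ⟦ does (∈D? ((f ^ k) (suc j))) ⟧)
  nonzeros-A^ k = trans (nonzeros-sum (A ^M k)) (Σℕ.sum-cong-≗ λ j →
    trans (Σℕ.sum-cong-≗ (λ i → cong nz (A^-entry k i j))) (nz-e ((f ^ k) (suc j))))

  -- The truncated Neumann series I + A + ... + A^(k-1) applied to `e y`, unrolled from the start of
  -- the orbit so that induction moves the base point to `f y`.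
  orbitSum : ℕ → Fin (suc n) → Vecℤ n
  orbitSum zero    y i = 0ℤ
  orbitSum (suc k) y i = e y i ℤ.+ orbitSum k (f y) i

  orbitSum-sum : ∀ k y i → orbitSum k y i ≡ sumℤ {k} (λ ν → e ((f ^ toℕ ν) y) i)
  orbitSum-sum zero    y i = refl
  orbitSum-sum (suc k) y i = cong (λ z → e y i ℤ.+ z) (trans (orbitSum-sum k (f y) i)
    (Σℤ.sum-cong-≗ {k} (λ ν → cong (λ z → e z i) (sym (^-suc (toℕ ν) y)))))

  orbitSum-zero : ∀ k i → orbitSum k zero i ≡ 0ℤ
  orbitSum-zero zero    i = refl
  orbitSum-zero (suc k) i = trans (ℤ.+-identityˡ _)
    (trans (cong (λ y → orbitSum k y i) f0≡0) (orbitSum-zero k i))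

  -- Once the orbit is at 0 it stays there, and every further term is the zero vector.
  orbitSum-stable : ∀ {j k} y i → j ≤ k → (f ^ j) y ≡ zero → orbitSum k y i ≡ orbitSum j y i
  orbitSum-stable {k = k} y i z≤n refl = orbitSum-zero k i
  orbitSum-stable {suc j} y i (s≤s j≤k) fʲ≡0 = cong (λ z → e y i ℤ.+ z)
    (orbitSum-stable (f y) i j≤k (trans (sym (^-suc j y)) fʲ≡0))

  orbitSum-avoid : ∀ k y i → (∀ ν → (f ^ ν) y ≢ suc i) → orbitSum k y i ≡ 0ℤ
  orbitSum-avoid zero    y i y≢i = refl
  orbitSum-avoid (suc k) y i y≢i = cong₂ ℤ._+_ (e-off y i (y≢i 0))
    (orbitSum-avoid k (f y) i (λ ν → y≢i (suc ν) ∘ trans (^-suc ν y)))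

  orbitSum-telescope : ∀ k y i → orbitSum k y i ℤ.- orbitSum k (f y) i ≡ e y i ℤ.- e ((f ^ k) y) i
  orbitSum-telescope zero    y i = sym (ℤ.+-inverseʳ (e y i))
  orbitSum-telescope (suc k) y i = begin
    (a ℤ.+ s) ℤ.- (b ℤ.+ t)          ≡⟨ regroup a s b t ⟩
    (a ℤ.- b) ℤ.+ (s ℤ.- t)          ≡⟨ cong (λ z → (a ℤ.- b) ℤ.+ z) (orbitSum-telescope k (f y) i) ⟩
    (a ℤ.- b) ℤ.+ (b ℤ.- c)          ≡⟨ [a-b]+[b-c]≡a-c a b c ⟩
    a ℤ.- c                          ≡⟨ cong (λ z → a ℤ.- e z i) (^-suc k y) ⟨
    a ℤ.- e ((f ^ suc k) y) i        ∎
    where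
    open ≡-Reasoning
    a b c s t : ℤ
    a = e y i
    b = e (f y) i
    c = e ((f ^ k) (f y)) i
    s = orbitSum k (f y) i
    t = orbitSum k (f (f y)) i
    regroup : ∀ a s b t → (a ℤ.+ s) ℤ.- (b ℤ.+ t) ≡ (a ℤ.- b) ℤ.+ (s ℤ.- t)
    regroup = ℤSolver.solve-∀

  -- `I -M A` sends `e y` to the difference of `e y` and `e (f y)`, so consecutive terms cancel
  -- along the orbit.
  [I-A]*orbitSum : ∀ k y i →
    sumℤ (λ l → (I -M A) i l ℤ.* orbitSum k y l) ≡ e y i ℤ.- e ((f ^ k) y) i
  [I-A]*orbitSum zero    y i = trans
    (trans (Σℤ.sum-cong-≗ (λ l → ℤ.*-zeroʳ ((I -M A) i l))) (Σℤ.sum-replicate-zero n))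
    (sym (ℤ.+-inverseʳ (e y i)))
  [I-A]*orbitSum (suc k) y i = begin
    sumℤ (λ l → (I -M A) i l ℤ.* (e y l ℤ.+ orbitSum k (f y) l))
      ≡⟨ Σℤ.sum-cong-≗ (λ l → ℤ.*-distribˡ-+ ((I -M A) i l) (e y l) (orbitSum k (f y) l)) ⟩
    sumℤ (λ l → (I -M A) i l ℤ.* e y l ℤ.+ (I -M A) i l ℤ.* orbitSum k (f y) l)
      ≡⟨ Σℤ.∑-distrib-+ (λ l → (I -M A) i l ℤ.* e y l) (λ l → (I -M A) i l ℤ.* orbitSum k (f y) l) ⟩
    sumℤ (λ l → (I -M A) i l ℤ.* e y l) ℤ.+ sumℤ (λ l → (I -M A) i l ℤ.* orbitSum k (f y) l)
      ≡⟨ cong₂ ℤ._+_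
           (sum-*-e (λ y → e y i ℤ.- e (f y) i) (cong (λ y → 0ℤ ℤ.- e y i) f0≡0) y)
           ([I-A]*orbitSum k (f y) i) ⟩
    (e y i ℤ.- e (f y) i) ℤ.+ (e (f y) i ℤ.- e ((f ^ k) (f y)) i)
      ≡⟨ [a-b]+[b-c]≡a-c (e y i) (e (f y) i) (e ((f ^ k) (f y)) i) ⟩
    e y i ℤ.- e ((f ^ k) (f y)) i
      ≡⟨ cong (λ z → e y i ℤ.- e z i) (^-suc k y) ⟨
    e y i ℤ.- e ((f ^ suc k) y) i  ∎
    where
    open ≡-Reasoning

  -- Column `j` of `I -M A` is a difference of two unit vectors, so the product is a difference of
  -- two orbit sums, which telescopes.
  orbitSum*[I-A] : ∀ k i j →
    sumℤ (λ l → orbitSum k (suc l) i ℤ.* (I -M A) l j) ≡ e (suc j) i ℤ.- e ((f ^ k) (suc j)) i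
  orbitSum*[I-A] k i j = begin
    sumℤ (λ l → S (suc l) ℤ.* (e (suc j) l ℤ.- e (f (suc j)) l))
      -- The minus sign moves onto `S`, which puts both halves in the form handled by `sum-*-e`.
      ≡⟨ Σℤ.sum-cong-≗ (λ l → expand (S (suc l)) (e (suc j) l) (e (f (suc j)) l)) ⟩
    sumℤ (λ l → S (suc l) ℤ.* e (suc j) l ℤ.+ (ℤ.- S (suc l)) ℤ.* e (f (suc j)) l)
      ≡⟨ Σℤ.∑-distrib-+ (λ l → S (suc l) ℤ.* e (suc j) l) (λ l → (ℤ.- S (suc l)) ℤ.* e (f (suc j)) l) ⟩
    sumℤ (λ l → S (suc l) ℤ.* e (suc j) l) ℤ.+ sumℤ (λ l → (ℤ.- S (suc l)) ℤ.* e (f (suc j)) l)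
      ≡⟨ cong₂ ℤ._+_
           (sum-*-e S (orbitSum-zero k i) (suc j))
           (sum-*-e (ℤ.-_ ∘ S) (cong ℤ.-_ (orbitSum-zero k i)) (f (suc j))) ⟩
    S (suc j) ℤ.- S (f (suc j))
      ≡⟨ orbitSum-telescope k (suc j) i ⟩
    e (suc j) i ℤ.- e ((f ^ k) (suc j)) i  ∎
    where
    open ≡-Reasoning
    S : Fin (suc n) → ℤ
    S y = orbitSum k y i
    expand : ∀ a b c → a ℤ.* (b ℤ.- c) ≡ a ℤ.* b ℤ.+ (ℤ.- a) ℤ.* c
    expand = ℤSolver.solve-∀

  -- All columns have the same length `n`, so that the inverse can be verified without heights.
  orbitSums : Mat n
  orbitSums i j = orbitSum n (suc j) i

-- Self-maps without cycles

-- Unlike in HasCycle, fixed points count as cycles.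
AcyclicOnD : ∀ {n} → (Fin (suc n) → Fin (suc n)) → Set
AcyclicOnD {n} f = ∀ k x → 1 ≤ k → (f ^ k) (suc x) ≢ suc x
  where open Endo (Fin (suc n)) using (_^_)

module Acyclic {n : ℕ} (f : Fin (suc n) → Fin (suc n)) (f0≡0 : f zero ≡ zero)
  (acyclic : AcyclicOnD f) where

  open Endo (Fin (suc n)) using (_^_)
  open Iteration f f0≡0 public

  -- Absence of cycles keeps the points distinct: where the leading unit vector has its 1 the
  -- remaining sum vanishes, so nothing cancels.
  orbitSum-support : ∀ k y → (∀ ν → ν < k → (f ^ ν) y ≢ zero) →
    sumℕ (λ i → nz (orbitSum k y i)) ≡ k
  orbitSum-support zero    y       _   = Σℕ.sum-replicate-zero n
  orbitSum-support (suc k) zero    y≢0 = contradiction refl (y≢0 0 (s≤s z≤n))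
  orbitSum-support (suc k) (suc j) y≢0 = begin
    sumℕ (λ i → nz (e (suc j) i ℤ.+ S i))
      ≡⟨ Σℕ.sum-cong-≗ split ⟩
    sumℕ (λ i → ⟦ does (i Fin.≟ j) ⟧ + nz (S i))
      ≡⟨ Σℕ.∑-distrib-+ (λ i → ⟦ does (i Fin.≟ j) ⟧) (nz ∘ S) ⟩
    sumℕ (λ i → ⟦ does (i Fin.≟ j) ⟧) + sumℕ (nz ∘ S)
      ≡⟨ cong₂ _+_ (sum-select ℕ.+-0-monoid (λ _ → 1) j)
           (orbitSum-support k (f (suc j)) (λ ν ν<k → y≢0 (suc ν) (s≤s ν<k) ∘ trans (^-suc ν (suc j)))) ⟩
    suc k  ∎
    where
    open ≡-Reasoning
    S : Vecℤ n
    S = orbitSum k (f (suc j))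
    split : ∀ i → nz (e (suc j) i ℤ.+ S i) ≡ ⟦ does (i Fin.≟ j) ⟧ + nz (S i)
    split i with i Fin.≟ j
    ... | no  _    = cong nz (ℤ.+-identityˡ (S i))
    ... | yes refl = trans (cong (λ z → nz (1ℤ ℤ.+ z)) S≡0) (cong (λ z → 1 + nz z) (sym S≡0))
      where
      S≡0 : S i ≡ 0ℤ
      S≡0 = orbitSum-avoid k (f (suc j)) j
        (λ ν → acyclic (suc ν) j (s≤s z≤n) ∘ trans (^-suc ν (suc j)))

  -- Otherwise the iterates with exponents 0 to `n` all lie in D_n, two of them agree, and their
  -- common value lies on a cycle.
  ^n≡0 : ∀ x → (f ^ n) (suc x) ≡ zero
  ^n≡0 x = decidable-stable ((f ^ n) (suc x) Fin.≟ zero) λ fⁿ≢0 →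
    let nonzero : ∀ (i : Fin (suc n)) → zero ≢ (f ^ toℕ i) (suc x)
        nonzero i 0≡fⁱ = fⁿ≢0 (^≡0-mono (suc x) (ℕ.≤-pred (Fin.toℕ<n i)) (sym 0≡fⁱ))
        -- Removing `zero` with `punchOut` leaves only `n` possible values.
        i , j , i<j , same = Fin.pigeonhole (ℕ.n<1+n n) (λ i → punchOut (nonzero i))
    in repeat (toℕ i) (toℕ j) i<j (nonzero i ∘ sym)
         (Fin.punchOut-injective (nonzero i) (nonzero j) same)
    where
    repeat : ∀ i j → i < j → (f ^ i) (suc x) ≢ zero → ¬ ((f ^ i) (suc x) ≡ (f ^ j) (suc x))
    repeat i j i<j fⁱ≢0 fⁱ≡fʲ with (f ^ i) (suc x) in eq
    ... | zero  = fⁱ≢0 refl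
    ... | suc z = acyclic (j ∸ i) z (ℕ.m<n⇒0<n∸m i<j) (begin
      (f ^ (j ∸ i)) (suc z)            ≡⟨ cong (f ^ (j ∸ i)) eq ⟨
      (f ^ (j ∸ i)) ((f ^ i) (suc x))  ≡⟨ ^-+ (j ∸ i) i (suc x) ⟨
      (f ^ (j ∸ i + i)) (suc x)        ≡⟨ cong (λ k → (f ^ k) (suc x)) (ℕ.m∸n+n≡m (ℕ.<⇒≤ i<j)) ⟩
      (f ^ j) (suc x)                  ≡⟨ fⁱ≡fʲ ⟨
      suc z                            ∎)
      where open ≡-Reasoning

  orbitSums-inverse : IsInverse (I -M A) orbitSums
  orbitSums-inverse = (λ i j → trans ([I-A]*orbitSum n (suc j) i) (last≡0 i j))
                    , (λ i j → trans (orbitSum*[I-A] n i j) (last≡0 i j))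
    where
    last≡0 : ∀ i j → e (suc j) i ℤ.- e ((f ^ n) (suc j)) i ≡ e (suc j) i
    last≡0 i j = trans (cong (λ y → e (suc j) i ℤ.- e y i) (^n≡0 j)) (ℤ.+-identityʳ _)

  height-exists : ∀ x → ∃ (IsMin λ k → 1 ≤ k × (f ^ k) (suc x) ≡ zero)
  height-exists x = least (λ k → (1 ℕ.≤? k) ×-dec ((f ^ k) (suc x) Fin.≟ zero)) n
    (n≥1 x , ^n≡0 x)
    where
    n≥1 : Fin n → 1 ≤ n
    n≥1 x = ℕ.≤-trans (s≤s z≤n) (Fin.toℕ<n x)

  -- Heights and level sizes.

  module Heights (h : Fin n → ℕ)
    (h-isHeight : ∀ x → IsMin (λ k → 1 ≤ k × (f ^ k) (suc x) ≡ zero) (h x)) where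

    h≥1 : ∀ x → 1 ≤ h x
    h≥1 x = proj₁ (proj₁ (h-isHeight x))

    ^h≡0 : ∀ x → (f ^ h x) (suc x) ≡ zero
    ^h≡0 x = proj₂ (proj₁ (h-isHeight x))

    ^≡0⇒h≤ : ∀ k x → (f ^ k) (suc x) ≡ zero → h x ≤ k
    -- The case `k = 0` cannot occur, as `suc x` is not `zero`.
    ^≡0⇒h≤ (suc k) x fᵏ≡0 = proj₂ (h-isHeight x) (suc k) (s≤s z≤n , fᵏ≡0)

    h≤n : ∀ x → h x ≤ n
    h≤n x = ^≡0⇒h≤ n x (^n≡0 x)

    -- The heights along an orbit decrease in steps of one.
    lower-height : ∀ x {ν} → 1 ≤ ν → ν ≤ h x → ∃ λ z → h z ≡ ν
    lower-height x {ν} ν≥1 ν≤h with (f ^ (h x ∸ ν)) (suc x) in eq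
    ... | zero  = contradiction (^≡0⇒h≤ (h x ∸ ν) x eq) (ℕ.<⇒≱ (ℕ.∸-monoʳ-< ν≥1 ν≤h))
    ... | suc z = z , ℕ.≤-antisym
      (^≡0⇒h≤ ν z (begin
        (f ^ ν) (suc z)            ≡⟨ later ν ⟩
        (f ^ (ν + d)) (suc x)      ≡⟨ cong (λ k → (f ^ k) (suc x)) (ℕ.m+[n∸m]≡n ν≤h) ⟩
        (f ^ h x) (suc x)          ≡⟨ ^h≡0 x ⟩
        zero                       ∎))
      (ℕ.+-cancelʳ-≤ d ν (h z) (subst (_≤ h z + d) (sym (ℕ.m+[n∸m]≡n ν≤h))
        (^≡0⇒h≤ (h z + d) x (trans (sym (later (h z))) (^h≡0 z)))))
      where
      open ≡-Reasoning
      d = h x ∸ ν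
      later : ∀ k → (f ^ k) (suc z) ≡ (f ^ (k + d)) (suc x)
      later k = trans (cong (f ^ k) (sym eq)) (sym (^-+ k d (suc x)))

    -- The terms from `h j` onwards are zero vectors, so the length `n` can be cut to `h j`.
    orbitSums-column : ∀ j → column orbitSums j ≗
      e (suc j) +ᵥ ∑ᵥ (h j ∸ 1) (λ ν → e ((f ^ ν) (suc j)))
    orbitSums-column j i = trans (orbitSum-stable (suc j) i (h≤n j) (^h≡0 j)) (head-tail (h≥1 j))
      where
      head-tail : ∀ {k} → 1 ≤ k →
        orbitSum k (suc j) i ≡ (e (suc j) +ᵥ ∑ᵥ (k ∸ 1) (λ ν → e ((f ^ ν) (suc j)))) i
      -- Here `k ∸ 1` does not truncate, and the term for `ν = 0` is the separate `e (suc j)`.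
      head-tail {suc k} _ = orbitSum-sum (suc k) (suc j) i

    nonzeros-orbitSums : nonzeros orbitSums ≡ sumℕ h
    nonzeros-orbitSums = trans (nonzeros-sum orbitSums) (Σℕ.sum-cong-≗ λ j → trans
      (Σℕ.sum-cong-≗ (λ i → cong nz (orbitSum-stable (suc j) i (h≤n j) (^h≡0 j))))
      (orbitSum-support (h j) (suc j) (λ ν ν<h fᵛ≡0 → ℕ.<⇒≱ ν<h (^≡0⇒h≤ ν j fᵛ≡0))))

    -- Each `x` is counted exactly once: column `x` of the power is nonzero if `h x > k`, and
    -- otherwise `x` lies in one of the first `k` levels.
    nonzeros-A^+levels : ∀ k → nonzeros (A ^M k) + ∑₁ k (levelSize h) ≡ n
    nonzeros-A^+levels k = begin
      nonzeros (A ^M k) + ∑₁ k (levelSize h)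
        ≡⟨ cong₂ _+_ (nonzeros-A^ k) (∑₁-levelSize h h≥1 k) ⟩
      sumℕ (λ x → ⟦ alive x ⟧) + sumℕ (λ x → ⟦ does (h x ℕ.≤? k) ⟧)
        ≡⟨ Σℕ.∑-distrib-+ (λ x → ⟦ alive x ⟧) (λ x → ⟦ does (h x ℕ.≤? k) ⟧) ⟨
      sumℕ (λ x → ⟦ alive x ⟧ + ⟦ does (h x ℕ.≤? k) ⟧)
        ≡⟨ Σℕ.sum-cong-≗ complementary ⟩
      sumℕ {n} (λ _ → 1)
        ≡⟨ sum-ones n ⟩
      n  ∎
      where
      open ≡-Reasoning
      alive : Fin n → Bool
      alive x = does (∈D? ((f ^ k) (suc x)))
      complementary : ∀ x → ⟦ alive x ⟧ + ⟦ does (h x ℕ.≤? k) ⟧ ≡ 1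
      complementary x with (f ^ k) (suc x) in eq
      ... | zero  = cong ⟦_⟧ (dec-true (h x ℕ.≤? k) (^≡0⇒h≤ k x eq))
      ... | suc _ = cong (λ b → 1 + ⟦ b ⟧) (dec-false (h x ℕ.≤? k)
        λ h≤k → Fin.0≢1+n (trans (sym (^≡0-mono (suc x) h≤k (^h≡0 x))) eq))

    -- The maximal height.

    module Top (x₀ : Fin n) where

      top : Fin n
      -- `argmax` over a list needs a default value, here any point of D_n.
      top = argmax h x₀ (allFin n)

      m : ℕ
      m = h top

      h≤m : ∀ x → h x ≤ m
      h≤m x = All.lookup (f[xs]≤f[argmax] x₀ (allFin n)) (∈-allFin x)

      levels-inhabited : ∀ {ν} → 1 ≤ ν → ν ≤ m → 1 ≤ levelSize h ν
      levels-inhabited ν≥1 ν≤m =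
        let z , hz≡ν = lower-height top ν≥1 ν≤m in levelSize≥1 h z hz≡ν

      levels-inhabited′ : ∀ (i : Fin m) → 1 ≤ levelSize h (suc (toℕ i))
      levels-inhabited′ i = levels-inhabited (s≤s z≤n) (Fin.toℕ<n i)

      -- Level `m` contains `top`, and levels above `m` are empty because `m` bounds all heights.
      m-isMax : IsMax (λ ν → (1 ≤ ν × ν ≤ n) × 1 ≤ levelSize h ν) m
      m-isMax = ((h≥1 top , h≤n top) , levelSize≥1 h top refl) , λ ν (_ , p≥1) →
        ℕ.≮⇒≥ λ m<ν → ℕ.<⇒≢ p≥1 (sym (levelSize≡0 h λ x hx≡ν →
          ℕ.<⇒≱ m<ν (subst (_≤ m) hx≡ν (h≤m x))))

      -- Every orbit is at 0 after `m` steps, but the orbit of `top` is still in D_n one step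
      -- earlier.
      A-nilpotent : IsNilpotentOfDegree A m
      A-nilpotent = (λ i j → trans (A^-entry m i j)
                      (cong (λ y → e y i) (^≡0-mono (suc j) (h≤m j) (^h≡0 j))))
                  , A^[m-1]≢0
        where
        A^[m-1]≢0 : ¬ (A ^M (m ∸ 1) ≈ 0M)
        A^[m-1]≢0 A≈0 with (f ^ (m ∸ 1)) (suc top) in eq
        ... | zero  = ℕ.<⇒≱ (ℕ.∸-monoʳ-< (s≤s z≤n) (h≥1 top)) (^≡0⇒h≤ (m ∸ 1) top eq)
        -- Column `top` of the power is `e (suc z)`, so its entry in row `z` would be both 1 and 0.
        ... | suc z with trans (sym (e-diag z))
                           (trans (cong (λ y → e y z) (sym eq))
                             (trans (sym (A^-entry (m ∸ 1) z top)) (A≈0 z top)))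
        ...   | ()

      -- The level sizes add up to `n`, which turns the weighted bound into one in terms of `n * m`.
      sum-h-bound : + ∑₁ m (λ ν → ν * levelSize h ν) ℤ.≤ + (n * m) ℤ.- + (m C 2)
      sum-h-bound = a+c≤b⇒a≤b-c (subst
        (λ s → ∑₁ m (λ ν → ν * levelSize h ν) + m C 2 ≤ s * m)
        (∑₁-levelSize-all h h≥1 h≤m)
        (∑₁-weighted-bound m (levelSize h) levels-inhabited′))

-- Specialisation to the local function of `φ`.

theorem1p7 : (φ : ℕ → ℕ) → φ 0 ≡ 0 → (∀ x → 1 ≤ x → φ x ≢ x) →
    (n : ℕ) → 2 ≤ n → ¬ HasCycle φ n →
    Σ[ h ∈ (Fin n → ℕ) ] (∀ x → IsHeight φ n x (h x)) ×
    Σ[ m ∈ ℕ ] IsMax (λ ν → (1 ≤ ν × ν ≤ n) × 1 ≤ levelSize h ν) m ×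
    (1 ≤ m × m ≤ n × IsComposition n {m} (λ i → levelSize h (suc (toℕ i)))) ×
    IsNilpotentOfDegree (M φ n) m ×
    (∀ k → 1 ≤ k → k ≤ m →
    (M φ n ^M k ≈ ∑M-where (λ x → ∈D? (iterate φ n k (suc x))) (λ x → E (iterate φ n k (suc x)) (suc x))) ×
    + nonzeros (M φ n ^M k) ≡ + n ℤ.- + ∑₁ k (levelSize h)) ×
    (Σ[ V ∈ Mat n ] IsInverse (M̂ φ n) V ×
    (∀ j → column V j ≗ e (suc j) +ᵥ ∑ᵥ (h j ∸ 1) (λ ν → e (iterate φ n ν (suc j)))) ×
    nonzeros V ≡ sumℕ h ×
    sumℕ h ≡ ∑₁ m (λ ν → ν * levelSize h ν) ×
    + ∑₁ m (λ ν → ν * levelSize h ν) ℤ.≤ + (n * m) ℤ.- + (m C 2))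
theorem1p7 φ _ _ n n≥2 noCycle =
  h , (proj₂ ∘ height-exists) , m , m-isMax ,
  (h≥1 top , h≤n top , levels-inhabited′ , ∑₁-levelSize-all h h≥1 h≤m) ,
  A-nilpotent ,
  (λ k _ _ → A^-sum k , a+c≡b⇒a≡b-c (nonzeros-A^+levels k)) ,
  orbitSums , orbitSums-inverse , orbitSums-column ,
  nonzeros-orbitSums , sum≡∑₁-levels h h≥1 h≤m , sum-h-bound
  where
  -- A fixed point would also be a cycle of length 2.
  acyclic : AcyclicOnD (local φ n)
  acyclic (suc zero)    x _ fx≡x = noCycle (2 , x , s≤s (s≤s z≤n) , trans (cong (local φ n) fx≡x) fx≡x)
  acyclic (suc (suc k)) x _ fᵏ≡x = noCycle (suc (suc k) , x , s≤s (s≤s z≤n) , fᵏ≡x)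

  open Acyclic (local φ n) refl acyclic

  h : Fin n → ℕ
  h = proj₁ ∘ height-exists

  open Heights h (proj₂ ∘ height-exists)
  -- The default point is the number 1, which lies in D_n by `n≥2`.
  open Top (fromℕ< (ℕ.<⇒≤ n≥2))
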